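{- Let $T_1=(V_1,E_1)$ and $T_2=(V_2,E_2)$ be trees with $|V_1|=|V_2|=n$. Then $S_{T_1}\cap S_{T_2}\ne\emptyset$ if and only if $T_1$ and $T_2$ are isomorphic.
   Context: $\mathbb{C}[S_n]$ is the group algebra of the symmetric group $S_n$. A labeling of a graph $G=(V,E)$ with $|V|=n$ is a bijection $\mathcal{L}:V\to\{1,\dots,n\}$; under it an edge $\{u,v\}$ corresponds to the transposition $(\mathcal{L}(u)\,\mathcal{L}(v))\in S_n$. For a labeling $\mathcal{L}$ and an ordering $\pi=(e_1,\dots,e_m)$ of $E$, $\mathcal{K}_{\mathcal{L},\pi}(G)=n!\,(1-t_1)(1-t_2)\cdots(1-t_m)\in\mathbb{C}[S_n]$, where $t_r$ is the transposition corresponding to $e_r$ under $\mathcal{L}$ and the product is in the order of $\pi$. Define $S_G=\{\mathcal{K}_{\mathcal{L},\pi}(G):\mathcal{L}\text{ a labeling of }V,\ \pi\text{ an ordering of }E\}$. -}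

module Defs where

open import Level using (0ℓ)
open import Algebra.Bundles using (CommutativeRing)
open import Algebra.Structures using (IsAbelianGroup)
import Algebra.Consequences.Setoid as Consequences
import Algebra.Definitions.RawMonoid as RawMonoid
open import Data.Bool.Base using (if_then_else_)
open import Data.Fin.Base using (Fin; zero; suc; inject₁; fromℕ)
import Data.Fin.Properties as Fin
import Data.Fin.Permutation as Perm
open import Data.Fin.Permutation
  using (Permutation′; transpose; _⟨$⟩ʳ_; _∘ₚ_)
open import Data.List.Base using (List; []; _∷_; [_]; _++_; map; cartesianProductWith)
open import Data.Nat.Base as ℕ using (ℕ; _!)
import Data.Nat.Properties as ℕ
open import Data.Product.Base using (Σ-syntax; ∃-syntax; _×_; _,_)
open import Data.Rational.Base as ℚ using (ℚ; 0ℚ; 1ℚ; ½; ∣_∣)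
import Data.Rational.Properties as ℚ
open import Data.Rational.Solver using (module +-*-Solver)
open import Data.Sum.Base using (_⊎_; inj₁; inj₂)
import Data.Vec.Functional as Vector
open import Function.Bundles using (Bijection; _⤖_; _⇔_)
open import Function.Definitions using (Injective)
open import Relation.Binary.Bundles using (Setoid)
open import Relation.Binary.Construct.Closure.ReflexiveTransitive using (Star)
open import Relation.Binary.Core using (Rel)
open import Relation.Binary.Definitions using (Symmetric; Irreflexive; Decidable)
open import Relation.Binary.PropositionalEquality
  using (_≡_; refl; sym; trans; cong; subst; setoid)
open import Relation.Nullary.Decidable using (does)
open import Relation.Nullary.Negation using (¬_)
open import Relation.Unary using (Pred)

------------------------------------------------------------------------
-- Real numbers: Cauchy sequences of rationals modulo null sequences

infix 4 _≃_

-- Without η, so that conversion checking does not compare convergence proofs.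
record ℝ : Set where
  no-eta-equality
  field
    seq    : ℕ → ℚ
    cauchy : ∀ ε → 0ℚ ℚ.< ε →
             ∃[ N ] (∀ m n → N ℕ.≤ m → N ℕ.≤ n → ∣ seq m ℚ.- seq n ∣ ℚ.< ε)

open ℝ public

record _≃_ (x y : ℝ) : Set where
  no-eta-equality
  field
    close : ∀ ε → 0ℚ ℚ.< ε →
            ∃[ N ] (∀ n → N ℕ.≤ n → ∣ seq x n ℚ.- seq y n ∣ ℚ.< ε)

open _≃_ public

private
  open +-*-Solver

  half-pos : ∀ {ε} → 0ℚ ℚ.< ε → 0ℚ ℚ.< ½ ℚ.* ε
  half-pos {ε} 0<ε = subst (ℚ._< ½ ℚ.* ε) (ℚ.*-zeroʳ ½) (ℚ.*-monoʳ-<-pos ½ 0<ε)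

  half+half : ∀ ε → ½ ℚ.* ε ℚ.+ ½ ℚ.* ε ≡ ε
  half+half ε = trans (sym (ℚ.*-distribʳ-+ ε ½ ½)) (ℚ.*-identityˡ ε)

  ∣+∣< : ∀ {a b ε} → ∣ a ∣ ℚ.< ½ ℚ.* ε → ∣ b ∣ ℚ.< ½ ℚ.* ε → ∣ a ℚ.+ b ∣ ℚ.< ε
  ∣+∣< {a} {b} {ε} p q = ℚ.≤-<-trans (ℚ.∣p+q∣≤∣p∣+∣q∣ a b)
    (subst (∣ a ∣ ℚ.+ ∣ b ∣ ℚ.<_) (half+half ε) (ℚ.+-mono-< p q))

  +-interchange : ∀ a b c d →
    (a ℚ.- c) ℚ.+ (b ℚ.- d) ≡ (a ℚ.+ b) ℚ.- (c ℚ.+ d)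
  +-interchange = solve 4 (λ a b c d →
    (a :- c) :+ (b :- d) := (a :+ b) :- (c :+ d)) refl

  ∣--∣ : ∀ a b → ∣ (ℚ.- a) ℚ.- (ℚ.- b) ∣ ≡ ∣ a ℚ.- b ∣
  ∣--∣ a b = trans
    (cong ∣_∣ (solve 2 (λ a b → (:- a) :- (:- b) := :- (a :- b)) refl a b))
    (ℚ.∣-p∣≡∣p∣ (a ℚ.- b))

  ∣-∣-sym : ∀ a b → ∣ a ℚ.- b ∣ ≡ ∣ b ℚ.- a ∣
  ∣-∣-sym a b = trans
    (cong ∣_∣ (solve 2 (λ a b → a :- b := :- (b :- a)) refl a b))
    (ℚ.∣-p∣≡∣p∣ (b ℚ.- a))

  telescope : ∀ a b c → (a ℚ.- b) ℚ.+ (b ℚ.- c) ≡ a ℚ.- c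
  telescope = solve 3 (λ a b c → (a :- b) :+ (b :- c) := a :- c) refl

  ∣*∣< : ∀ {B δ a b} .{{_ : ℚ.Positive B}} →
         ∣ a ∣ ℚ.< B → ∣ b ∣ ℚ.< δ → ∣ a ℚ.* b ∣ ℚ.< B ℚ.* δ
  ∣*∣< {B} {δ} {a} {b} p q = ℚ.≤-<-trans
    (subst (ℚ._≤ B ℚ.* ∣ b ∣) (sym (ℚ.∣p*q∣≡∣p∣*∣q∣ a b))
      (ℚ.*-monoʳ-≤-nonNeg ∣ b ∣ {{ℚ.∣-∣-nonNeg b}} (ℚ.<⇒≤ p)))
    (ℚ.*-monoʳ-<-pos B q)

  *-close : ∀ {B δ ε a a′ b b′} .{{_ : ℚ.Positive B}} → B ℚ.* δ ≡ ½ ℚ.* ε →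
            ∣ a ∣ ℚ.< B → ∣ b′ ∣ ℚ.< B → ∣ a ℚ.- a′ ∣ ℚ.< δ → ∣ b ℚ.- b′ ∣ ℚ.< δ →
            ∣ a ℚ.* b ℚ.- a′ ℚ.* b′ ∣ ℚ.< ε
  *-close {B} {δ} {ε} {a} {a′} {b} {b′} eq a<B b′<B da db =
    subst (λ z → ∣ z ∣ ℚ.< ε)
      (solve 4 (λ a a′ b b′ → a :* (b :- b′) :+ b′ :* (a :- a′)
                           := a :* b :- a′ :* b′) refl a a′ b b′)
      (∣+∣< (subst (∣ a ℚ.* (b ℚ.- b′) ∣ ℚ.<_) eq (∣*∣< a<B db))
            (subst (∣ b′ ℚ.* (a ℚ.- a′) ∣ ℚ.<_) eq (∣*∣< b′<B da)))

  Bound : (ℕ → ℚ) → ℚ → Set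
  Bound s B = ∃[ N ] (∀ n → N ℕ.≤ n → ∣ s n ∣ ℚ.< B)

  bounded : ∀ x → ∃[ B ] (0ℚ ℚ.< B × Bound (seq x) B)
  bounded x with cauchy x 1ℚ (ℚ.positive⁻¹ 1ℚ)
  ... | N , c = 1ℚ ℚ.+ ∣ seq x N ∣
              , ℚ.+-mono-<-≤ (ℚ.positive⁻¹ 1ℚ) (ℚ.0≤∣p∣ (seq x N))
              , N , λ n N≤n → ℚ.≤-<-trans
                  (subst (λ z → ∣ z ∣ ℚ.≤ ∣ seq x n ℚ.- seq x N ∣ ℚ.+ ∣ seq x N ∣)
                    (solve 2 (λ a b → (a :- b) :+ b := a) refl (seq x n) (seq x N))
                    (ℚ.∣p+q∣≤∣p∣+∣q∣ (seq x n ℚ.- seq x N) (seq x N)))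
                  (ℚ.+-monoˡ-< ∣ seq x N ∣ (c n N N≤n ℕ.≤-refl))

  <-+ʳ : ∀ {p} b c → p ℚ.< b → 0ℚ ℚ.< c → p ℚ.< b ℚ.+ c
  <-+ʳ {p} b c p<b 0<c =
    subst (ℚ._< b ℚ.+ c) (ℚ.+-identityʳ p) (ℚ.+-mono-< {p} {b} {0ℚ} {c} p<b 0<c)

  <-+ˡ : ∀ {p} b c → p ℚ.< c → 0ℚ ℚ.< b → p ℚ.< b ℚ.+ c
  <-+ˡ {p} b c p<c 0<b =
    subst (ℚ._< b ℚ.+ c) (ℚ.+-identityˡ p) (ℚ.+-mono-< {0ℚ} {b} {p} {c} 0<b p<c)

  commonBound : ∀ x y → ∃[ B ] (0ℚ ℚ.< B × Bound (seq x) B × Bound (seq y) B)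
  commonBound x y =
    let B , 0<B , M , p = bounded x
        C , 0<C , N , q = bounded y
    in B ℚ.+ C , <-+ʳ B C 0<B 0<C
       , (M , λ n h → <-+ʳ B C (p n h) 0<C)
       , (N , λ n h → <-+ˡ B C (q n h) 0<B)

  tolerance : ∀ {B ε} → 0ℚ ℚ.< B → 0ℚ ℚ.< ε →
              ∃[ δ ] (0ℚ ℚ.< δ × B ℚ.* δ ≡ ½ ℚ.* ε)
  tolerance {B} {ε} 0<B 0<ε = 1/B ℚ.* (½ ℚ.* ε)
    , subst (ℚ._< 1/B ℚ.* (½ ℚ.* ε)) (ℚ.*-zeroʳ 1/B)
        (ℚ.*-monoʳ-<-pos 1/B {{ℚ.1/pos⇒pos B}} (half-pos 0<ε))
    , trans (sym (ℚ.*-assoc B 1/B (½ ℚ.* ε)))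
        (trans (cong (ℚ._* (½ ℚ.* ε)) (ℚ.*-inverseʳ B)) (ℚ.*-identityˡ _))
    where
    instance
      B>0 : ℚ.Positive B
      B>0 = ℚ.positive 0<B
      B≢0 : ℚ.NonZero B
      B≢0 = ℚ.pos⇒nonZero B
    1/B : ℚ
    1/B = ℚ.1/ B

  ⊔₁ : ∀ {a b n} → a ℕ.⊔ b ℕ.≤ n → a ℕ.≤ n
  ⊔₁ {a} {b} = ℕ.≤-trans (ℕ.m≤m⊔n a b)

  ⊔₂ : ∀ {a b n} → a ℕ.⊔ b ℕ.≤ n → b ℕ.≤ n
  ⊔₂ {a} {b} = ℕ.≤-trans (ℕ.m≤n⊔m a b)

pointwise : ∀ {x y} → (∀ n → seq x n ≡ seq y n) → x ≃ y
close (pointwise {x} {y} eq) ε 0<ε =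
  0 , λ n _ → subst (λ z → ∣ z ∣ ℚ.< ε)
    (sym (trans (cong (ℚ._- seq y n) (eq n)) (ℚ.+-inverseʳ (seq y n)))) 0<ε

≃-refl : ∀ {x} → x ≃ x
≃-refl = pointwise (λ _ → refl)

≃-sym : ∀ {x y} → x ≃ y → y ≃ x
close (≃-sym {x} {y} p) ε 0<ε with close p ε 0<ε
... | N , h = N , λ n k → subst (ℚ._< ε) (∣-∣-sym (seq x n) (seq y n)) (h n k)

≃-trans : ∀ {x y z} → x ≃ y → y ≃ z → x ≃ z
close (≃-trans {x} {y} {z} p q) ε 0<ε
  with close p (½ ℚ.* ε) (half-pos 0<ε) | close q (½ ℚ.* ε) (half-pos 0<ε)
... | M , f | N , g = M ℕ.⊔ N , λ n k →
  subst (λ r → ∣ r ∣ ℚ.< ε) (telescope (seq x n) (seq y n) (seq z n))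
    (∣+∣< (f n (⊔₁ k)) (g n (⊔₂ {M} k)))

fromℚ : ℚ → ℝ
seq    (fromℚ q) _ = q
cauchy (fromℚ q) ε 0<ε =
  0 , λ _ _ _ _ → subst (λ z → ∣ z ∣ ℚ.< ε) (sym (ℚ.+-inverseʳ q)) 0<ε

infixl 6 _+ᵣ_ _-ᵣ_
infixl 7 _*ᵣ_
infix  8 -ᵣ_

_+ᵣ_ : ℝ → ℝ → ℝ
seq    (x +ᵣ y) n = seq x n ℚ.+ seq y n
cauchy (x +ᵣ y) ε 0<ε
  with cauchy x (½ ℚ.* ε) (half-pos 0<ε) | cauchy y (½ ℚ.* ε) (half-pos 0<ε)
... | M , f | N , g = M ℕ.⊔ N , λ m n h k →
  subst (λ z → ∣ z ∣ ℚ.< ε) (+-interchange (seq x m) (seq y m) (seq x n) (seq y n))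
    (∣+∣< (f m n (⊔₁ h) (⊔₁ k)) (g m n (⊔₂ {M} h) (⊔₂ {M} k)))

-ᵣ_ : ℝ → ℝ
seq    (-ᵣ x) n = ℚ.- seq x n
cauchy (-ᵣ x) ε 0<ε with cauchy x ε 0<ε
... | N , f = N , λ m n h k →
  subst (ℚ._< ε) (sym (∣--∣ (seq x m) (seq x n))) (f m n h k)

_-ᵣ_ : ℝ → ℝ → ℝ
x -ᵣ y = x +ᵣ (-ᵣ y)

_*ᵣ_ : ℝ → ℝ → ℝ
seq    (x *ᵣ y) n = seq x n ℚ.* seq y n
cauchy (x *ᵣ y) ε 0<ε =
  let B , 0<B , (M , p) , (N , q) = commonBound x y
      δ , 0<δ , eq = tolerance 0<B 0<ε
      K , f = cauchy x δ 0<δ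
      L , g = cauchy y δ 0<δ
  in (M ℕ.⊔ N) ℕ.⊔ (K ℕ.⊔ L) , λ m n h k →
  *-close {B} {δ} {ε} {seq x m} {seq x n} {seq y m} {seq y n} {{ℚ.positive 0<B}} eq
    (p m (⊔₁ {M} (⊔₁ {M ℕ.⊔ N} h))) (q n (⊔₂ {M} (⊔₁ {M ℕ.⊔ N} k)))
    (f m n (⊔₁ {K} (⊔₂ {M ℕ.⊔ N} h)) (⊔₁ {K} (⊔₂ {M ℕ.⊔ N} k)))
    (g m n (⊔₂ {K} (⊔₂ {M ℕ.⊔ N} h)) (⊔₂ {K} (⊔₂ {M ℕ.⊔ N} k)))

+ᵣ-cong : ∀ {x x′ y y′} → x ≃ x′ → y ≃ y′ → x +ᵣ y ≃ x′ +ᵣ y′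
close (+ᵣ-cong {x} {x′} {y} {y′} p q) ε 0<ε
  with close p (½ ℚ.* ε) (half-pos 0<ε) | close q (½ ℚ.* ε) (half-pos 0<ε)
... | M , f | N , g = M ℕ.⊔ N , λ n k →
  subst (λ z → ∣ z ∣ ℚ.< ε) (+-interchange (seq x n) (seq y n) (seq x′ n) (seq y′ n))
    (∣+∣< (f n (⊔₁ k)) (g n (⊔₂ {M} k)))

-ᵣ-cong : ∀ {x x′} → x ≃ x′ → -ᵣ x ≃ -ᵣ x′
close (-ᵣ-cong {x} {x′} p) ε 0<ε with close p ε 0<ε
... | N , f = N , λ n k →
  subst (ℚ._< ε) (sym (∣--∣ (seq x n) (seq x′ n))) (f n k)

*ᵣ-cong : ∀ {x x′ y y′} → x ≃ x′ → y ≃ y′ → x *ᵣ y ≃ x′ *ᵣ y′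
close (*ᵣ-cong {x} {x′} {y} {y′} r s) ε 0<ε =
  let B , 0<B , (M , p) , (N , q) = commonBound x y′
      δ , 0<δ , eq = tolerance 0<B 0<ε
      K , f = close r δ 0<δ
      L , g = close s δ 0<δ
  in (M ℕ.⊔ N) ℕ.⊔ (K ℕ.⊔ L) , λ n k →
  *-close {B} {δ} {ε} {seq x n} {seq x′ n} {seq y n} {seq y′ n} {{ℚ.positive 0<B}} eq
    (p n (⊔₁ {M} (⊔₁ {M ℕ.⊔ N} k))) (q n (⊔₂ {M} (⊔₁ {M ℕ.⊔ N} k)))
    (f n (⊔₁ {K} (⊔₂ {M ℕ.⊔ N} k))) (g n (⊔₂ {K} (⊔₂ {M ℕ.⊔ N} k)))

------------------------------------------------------------------------
-- Complex numbers

infix 4 _≈ᶜ_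

record ℂ : Set where
  constructor _+i_
  field
    re im : ℝ

open ℂ public

record _≈ᶜ_ (w z : ℂ) : Set where
  constructor _,_
  field
    re≃ : re w ≃ re z
    im≃ : im w ≃ im z

open _≈ᶜ_ public

infixl 6 _+ᶜ_
infixl 7 _*ᶜ_
infix  8 -ᶜ_

0ᶜ 1ᶜ : ℂ
0ᶜ = fromℚ 0ℚ +i fromℚ 0ℚ
1ᶜ = fromℚ 1ℚ +i fromℚ 0ℚ

_+ᶜ_ _*ᶜ_ : ℂ → ℂ → ℂ
(a +i b) +ᶜ (c +i d) = (a +ᵣ c) +i (b +ᵣ d)
(a +i b) *ᶜ (c +i d) = (a *ᵣ c -ᵣ b *ᵣ d) +i (a *ᵣ d +ᵣ b *ᵣ c)

-ᶜ_ : ℂ → ℂ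
-ᶜ (a +i b) = (-ᵣ a) +i (-ᵣ b)

private
  mulRe-assoc : ∀ a b c d e f →
    (a ℚ.* c ℚ.- b ℚ.* d) ℚ.* e ℚ.- (a ℚ.* d ℚ.+ b ℚ.* c) ℚ.* f
    ≡ a ℚ.* (c ℚ.* e ℚ.- d ℚ.* f) ℚ.- b ℚ.* (c ℚ.* f ℚ.+ d ℚ.* e)
  mulRe-assoc = solve 6 (λ a b c d e f →
    (a :* c :- b :* d) :* e :- (a :* d :+ b :* c) :* f
    := a :* (c :* e :- d :* f) :- b :* (c :* f :+ d :* e)) refl

  mulIm-assoc : ∀ a b c d e f →
    (a ℚ.* c ℚ.- b ℚ.* d) ℚ.* f ℚ.+ (a ℚ.* d ℚ.+ b ℚ.* c) ℚ.* e
    ≡ a ℚ.* (c ℚ.* f ℚ.+ d ℚ.* e) ℚ.+ b ℚ.* (c ℚ.* e ℚ.- d ℚ.* f)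
  mulIm-assoc = solve 6 (λ a b c d e f →
    (a :* c :- b :* d) :* f :+ (a :* d :+ b :* c) :* e
    := a :* (c :* f :+ d :* e) :+ b :* (c :* e :- d :* f)) refl

  mulRe-identityˡ : ∀ a b →
    1ℚ ℚ.* a ℚ.- 0ℚ ℚ.* b
    ≡ a
  mulRe-identityˡ = solve 2 (λ a b →
    con 1ℚ :* a :- con 0ℚ :* b
    := a) refl

  mulIm-identityˡ : ∀ a b →
    1ℚ ℚ.* b ℚ.+ 0ℚ ℚ.* a
    ≡ b
  mulIm-identityˡ = solve 2 (λ a b →
    con 1ℚ :* b :+ con 0ℚ :* a
    := b) refl

  mulRe-distribˡ : ∀ a b c d e f →
    a ℚ.* (c ℚ.+ e) ℚ.- b ℚ.* (d ℚ.+ f)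
    ≡ (a ℚ.* c ℚ.- b ℚ.* d) ℚ.+ (a ℚ.* e ℚ.- b ℚ.* f)
  mulRe-distribˡ = solve 6 (λ a b c d e f →
    a :* (c :+ e) :- b :* (d :+ f)
    := (a :* c :- b :* d) :+ (a :* e :- b :* f)) refl

  mulIm-distribˡ : ∀ a b c d e f →
    a ℚ.* (d ℚ.+ f) ℚ.+ b ℚ.* (c ℚ.+ e)
    ≡ (a ℚ.* d ℚ.+ b ℚ.* c) ℚ.+ (a ℚ.* f ℚ.+ b ℚ.* e)
  mulIm-distribˡ = solve 6 (λ a b c d e f →
    a :* (d :+ f) :+ b :* (c :+ e)
    := (a :* d :+ b :* c) :+ (a :* f :+ b :* e)) refl

  mulRe-comm : ∀ a b c d →
    a ℚ.* c ℚ.- b ℚ.* d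
    ≡ c ℚ.* a ℚ.- d ℚ.* b
  mulRe-comm = solve 4 (λ a b c d →
    a :* c :- b :* d
    := c :* a :- d :* b) refl

  mulIm-comm : ∀ a b c d →
    a ℚ.* d ℚ.+ b ℚ.* c
    ≡ c ℚ.* b ℚ.+ d ℚ.* a
  mulIm-comm = solve 4 (λ a b c d →
    a :* d :+ b :* c
    := c :* b :+ d :* a) refl

*ᶜ-cong : ∀ {w w′ z z′} → w ≈ᶜ w′ → z ≈ᶜ z′ → w *ᶜ z ≈ᶜ w′ *ᶜ z′
*ᶜ-cong (p , q) (r , s) =
    +ᵣ-cong (*ᵣ-cong p r) (-ᵣ-cong (*ᵣ-cong q s))
  , +ᵣ-cong (*ᵣ-cong p s) (*ᵣ-cong q r)

*ᶜ-assoc : ∀ x y z → (x *ᶜ y) *ᶜ z ≈ᶜ x *ᶜ (y *ᶜ z)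
*ᶜ-assoc (a +i b) (c +i d) (e +i f) =
    pointwise (λ n → mulRe-assoc (seq a n) (seq b n) (seq c n) (seq d n) (seq e n) (seq f n))
  , pointwise (λ n → mulIm-assoc (seq a n) (seq b n) (seq c n) (seq d n) (seq e n) (seq f n))

*ᶜ-comm : ∀ x y → x *ᶜ y ≈ᶜ y *ᶜ x
*ᶜ-comm (a +i b) (c +i d) =
    pointwise (λ n → mulRe-comm (seq a n) (seq b n) (seq c n) (seq d n))
  , pointwise (λ n → mulIm-comm (seq a n) (seq b n) (seq c n) (seq d n))

*ᶜ-identityˡ : ∀ x → 1ᶜ *ᶜ x ≈ᶜ x
*ᶜ-identityˡ (a +i b) =
    pointwise (λ n → mulRe-identityˡ (seq a n) (seq b n))
  , pointwise (λ n → mulIm-identityˡ (seq a n) (seq b n))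

*ᶜ-distribˡ-+ᶜ : ∀ x y z → x *ᶜ (y +ᶜ z) ≈ᶜ x *ᶜ y +ᶜ x *ᶜ z
*ᶜ-distribˡ-+ᶜ (a +i b) (c +i d) (e +i f) =
    pointwise (λ n → mulRe-distribˡ (seq a n) (seq b n) (seq c n) (seq d n) (seq e n) (seq f n))
  , pointwise (λ n → mulIm-distribˡ (seq a n) (seq b n) (seq c n) (seq d n) (seq e n) (seq f n))

+ᶜ-isAbelianGroup : IsAbelianGroup _≈ᶜ_ _+ᶜ_ 0ᶜ -ᶜ_
+ᶜ-isAbelianGroup = record
  { isGroup = record
    { isMonoid = record
      { isSemigroup = record
        { isMagma = record
          { isEquivalence = record
            { refl  = ≃-refl , ≃-refl
            ; sym   = λ { (p , q) → ≃-sym p , ≃-sym q }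
            ; trans = λ { (p , q) (r , s) → ≃-trans p r , ≃-trans q s }
            }
          ; ∙-cong = λ { (p , q) (r , s) → +ᵣ-cong p r , +ᵣ-cong q s }
          }
        ; assoc = λ x y z →
            pointwise (λ n → ℚ.+-assoc (seq (re x) n) (seq (re y) n) (seq (re z) n))
          , pointwise (λ n → ℚ.+-assoc (seq (im x) n) (seq (im y) n) (seq (im z) n))
        }
      ; identity =
          (λ x → pointwise (λ n → ℚ.+-identityˡ (seq (re x) n))
               , pointwise (λ n → ℚ.+-identityˡ (seq (im x) n)))
        , (λ x → pointwise (λ n → ℚ.+-identityʳ (seq (re x) n))
               , pointwise (λ n → ℚ.+-identityʳ (seq (im x) n)))
      }
    ; inverse =
        (λ x → pointwise (λ n → ℚ.+-inverseˡ (seq (re x) n))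
             , pointwise (λ n → ℚ.+-inverseˡ (seq (im x) n)))
      , (λ x → pointwise (λ n → ℚ.+-inverseʳ (seq (re x) n))
             , pointwise (λ n → ℚ.+-inverseʳ (seq (im x) n)))
    ; ⁻¹-cong = λ { (p , q) → -ᵣ-cong p , -ᵣ-cong q }
    }
  ; comm = λ x y → pointwise (λ n → ℚ.+-comm (seq (re x) n) (seq (re y) n))
                 , pointwise (λ n → ℚ.+-comm (seq (im x) n) (seq (im y) n))
  }

ℂ-commutativeRing : CommutativeRing 0ℓ 0ℓ
ℂ-commutativeRing = record
  { isCommutativeRing = record
    { isRing = record
      { +-isAbelianGroup = +ᶜ-isAbelianGroup
      ; *-cong           = *ᶜ-cong
      ; *-assoc          = *ᶜ-assoc
      ; *-identity       = comm∧idˡ⇒id *ᶜ-comm *ᶜ-identityˡ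
      ; distrib          = comm∧distrˡ⇒distr +ᶜ-cong *ᶜ-comm *ᶜ-distribˡ-+ᶜ
      }
    ; *-comm = *ᶜ-comm
    }
  }
  where
  open IsAbelianGroup +ᶜ-isAbelianGroup using () renaming (∙-cong to +ᶜ-cong; setoid to ℂ-setoid)
  open Consequences ℂ-setoid using (comm∧idˡ⇒id; comm∧distrˡ⇒distr)

fromℕᶜ : ℕ → ℂ
fromℕᶜ k = k ×ᶜ 1ᶜ
  where open RawMonoid (CommutativeRing.+-rawMonoid ℂ-commutativeRing)
          using () renaming (_×_ to _×ᶜ_)

------------------------------------------------------------------------
-- The group algebra ℂ[Sₙ]

infixl 7 _∙_
infix  4 _≟ₚ_

-- Composition of functions, right factor applied first; the library's _∘ₚ_ is
-- the opposite composition.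
_∙_ : ∀ {n} → Permutation′ n → Permutation′ n → Permutation′ n
σ ∙ τ = τ ∘ₚ σ

_≟ₚ_ : ∀ {n} → Decidable (Perm._≈_ {n} {n})
σ ≟ₚ τ = Fin.all? (λ i → (σ ⟨$⟩ʳ i) Fin.≟ (τ ⟨$⟩ʳ i))

-- Formal linear combinations of permutations. A permutation may be listed
-- several times, so the elements of ℂ[Sₙ] are the classes of _≋_, which compares
-- all coefficients.
ℂ[S_] : ℕ → Set
ℂ[S n ] = List (ℂ × Permutation′ n)

infix  4 _≋_
infixl 6 _⊖_
infixl 7 _⊛_
infixr 7 _•_

coeff : ∀ {n} → ℂ[S n ] → Permutation′ n → ℂ
coeff []            σ = 0ᶜ
coeff ((c , τ) ∷ a) σ = (if does (τ ≟ₚ σ) then c else 0ᶜ) +ᶜ coeff a σ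

_≋_ : ∀ {n} → Rel ℂ[S n ] 0ℓ
a ≋ b = ∀ σ → coeff a σ ≈ᶜ coeff b σ

⟪_⟫ : ∀ {n} → Permutation′ n → ℂ[S n ]
⟪ σ ⟫ = [ 1ᶜ , σ ]

𝟏 : ∀ {n} → ℂ[S n ]
𝟏 = ⟪ Perm.id ⟫

_•_ : ∀ {n} → ℂ → ℂ[S n ] → ℂ[S n ]
c • a = map (λ (d , σ) → c *ᶜ d , σ) a

_⊖_ : ∀ {n} → ℂ[S n ] → ℂ[S n ] → ℂ[S n ]
a ⊖ b = a ++ map (λ (c , σ) → -ᶜ c , σ) b

_⊛_ : ∀ {n} → ℂ[S n ] → ℂ[S n ] → ℂ[S n ]
_⊛_ = cartesianProductWith (λ (c , σ) (d , τ) → c *ᶜ d , σ ∙ τ)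

∏ : ∀ {n m} → (Fin m → ℂ[S n ]) → ℂ[S n ]
∏ = Vector.foldr _⊛_ 𝟏

------------------------------------------------------------------------
-- Simple graphs

-- Finiteness is not part of the record; it comes with a bijection V ⤖ Fin n.
-- Decidability of adjacency is then what makes the edge set finite
-- constructively.
record Graph : Set₁ where
  infix 4 _~_
  field
    V        : Set
    _~_      : Rel V 0ℓ
    ~-sym    : Symmetric _~_
    ~-irrefl : Irreflexive _≡_ _~_
    _~?_     : Decidable _~_

module _ (G : Graph) where
  open Graph G

  -- An edge is given with one of its two orientations; _≈ₑ_ identifies them.
  Edge : Set
  Edge = Σ[ (u , v) ∈ V × V ] u ~ v

  _≈ₑ_ : Rel Edge 0ℓ
  ((u , v) , _) ≈ₑ ((u′ , v′) , _) = (u ≡ u′ × v ≡ v′) ⊎ (u ≡ v′ × v ≡ u′)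

  E : Setoid 0ℓ 0ℓ
  E = record
    { Carrier       = Edge
    ; _≈_           = _≈ₑ_
    ; isEquivalence = record
      { refl  = inj₁ (refl , refl)
      ; sym   = λ { (inj₁ (refl , refl)) → inj₁ (refl , refl)
                  ; (inj₂ (refl , refl)) → inj₂ (refl , refl) }
      ; trans = λ { (inj₁ (refl , refl)) q → q
                  ; (inj₂ (refl , refl)) (inj₁ (refl , refl)) → inj₂ (refl , refl)
                  ; (inj₂ (refl , refl)) (inj₂ (refl , refl)) → inj₁ (refl , refl) }
      }
    }

  Connected : Set
  Connected = ∀ u v → Star _~_ u v

  -- A cycle of length 3 + k, listed from one of its vertices.
  record Cycle : Set where
    field
      {k}      : ℕ
      vertex   : Fin (3 ℕ.+ k) → V
      distinct : Injective _≡_ _≡_ vertex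
      step     : ∀ (i : Fin (2 ℕ.+ k)) → vertex (inject₁ i) ~ vertex (suc i)
      closing  : vertex (fromℕ (2 ℕ.+ k)) ~ vertex zero

  record IsTree : Set where
    field
      nonEmpty  : V
      connected : Connected
      acyclic   : ¬ Cycle

  Labeling : ℕ → Set
  Labeling n = V ⤖ Fin n

  Ordering : ℕ → Set
  Ordering m = Bijection (setoid (Fin m)) E

  transposition : ∀ {n} → Labeling n → Edge → Permutation′ n
  transposition ℒ ((u , v) , _) = transpose (ℒ.to u) (ℒ.to v)
    where module ℒ = Bijection ℒ

  𝒦 : ∀ {n m} → Labeling n → Ordering m → ℂ[S n ]
  𝒦 {n} ℒ π = fromℕᶜ (n !) • ∏ (λ r → 𝟏 ⊖ ⟪ transposition ℒ (Bijection.to π r) ⟫)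

  -- m is determined by the bijection π: it is the number of edges.
  𝒮 : ∀ n → Pred ℂ[S n ] 0ℓ
  𝒮 n a = ∃[ ℒ ] ∃[ m ] Σ[ π ∈ Ordering m ] a ≋ 𝒦 {n} ℒ π

record _≅_ (G H : Graph) : Set where
  private
    module G = Graph G
    module H = Graph H
  field
    bijection : G.V ⤖ H.V
  open Bijection bijection public using (to)
  field
    adjacency : ∀ u v → (u G.~ v) ⇔ (to u H.~ to v)

{-# OPTIONS --safe #-}
module Submission where

-- Expand the product over the edges of a forest. Every permutation that occurs
-- moves points along paths of the forest, and since each edge is a bridge, the
-- transposition (a b) occurs exactly once, with sign −1, if {a , b} is an edge and
-- not at all otherwise. So 𝒦 determines the edges between labels, and equal
-- elements give an isomorphism by matching labels.

open import Defs
open import Level using (0ℓ)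
open import Algebra.Bundles using (CommutativeRing)
import Algebra.Properties.Ring as RingProperties
open import Data.Bool.Base using (if_then_else_; true; false)
open import Data.Empty using (⊥-elim)
open import Data.Fin.Base using (Fin; zero; suc; inject₁; fromℕ; _<_)
import Data.Fin.Properties as Fin
import Data.Fin.Permutation as Perm
import Data.Fin.Permutation.Components as Components
open import Data.Fin.Permutation
  using (Permutation′; transpose; _⟨$⟩ʳ_; _⟨$⟩ˡ_; inverseˡ; inverseʳ)
open import Data.List.Base
  using (List; []; _∷_; _++_; map; length; lookup; filter; cartesianProduct; allFin)
open import Data.List.Membership.Propositional using (_∈_)
open import Data.List.Membership.Propositional.Properties
  using (∈-filter⁺; ∈-filter⁻; ∈-cartesianProduct⁺; ∈-allFin; ∈-lookup)
open import Data.List.Properties using (++-identityʳ)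
import Data.List.Relation.Unary.All as All
open import Data.List.Relation.Unary.AllPairs using (_∷_)
open import Data.List.Relation.Unary.Any using (index)
open import Data.List.Relation.Unary.Any.Properties using (lookup-index)
open import Data.List.Relation.Unary.Unique.Propositional using (Unique)
import Data.List.Relation.Unary.Unique.Propositional.Properties as Unique
open import Data.Nat.Base as ℕ using (ℕ; zero; suc; _!)
import Data.Nat.Properties as ℕ
open import Data.Product.Base using (∃-syntax; Σ-syntax; _×_; _,_; proj₁; proj₂)
open import Data.Product.Properties using (,-injectiveˡ; ,-injectiveʳ)
open import Data.Rational.Base as ℚ using (0ℚ; 1ℚ; ∣_∣)
import Data.Rational.Properties as ℚ
open import Data.Sum.Base using (inj₁; inj₂)
open import Function.Base using (_∘_)
open import Function.Bundles
  using (Bijection; Inverse; Equivalence; _⤖_; _⇔_; mk⇔)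
open import Function.Construct.Composition using (_⤖-∘_)
open import Function.Construct.Symmetry using (⤖-sym)
open import Function.Definitions using (Injective)
open import Function.Properties.Bijection using (⤖⇒↔)
open import Relation.Binary.Construct.Closure.Equivalence as EqClosure using (EqClosure)
open import Relation.Binary.Construct.Closure.ReflexiveTransitive as Star
  using (Star; ε; _◅_; _◅◅_)
open import Relation.Binary.Construct.Closure.Symmetric using (SymClosure; fwd; bwd)
open import Relation.Binary.Core using (Rel)
open import Relation.Binary.Definitions using (DecidableEquality; tri<; tri≈; tri>)
open import Relation.Binary.PropositionalEquality
  using (_≡_; _≢_; refl; sym; trans; cong; cong₂; subst; subst₂)
open import Relation.Nullary.Decidable
  using (Dec; yes; no; does; does-⇔; dec-true; dec-false; via-injection; _×-dec_)
open import Relation.Nullary.Negation using (¬_; contradiction)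
open import Relation.Unary using (_∩_; Satisfiable)

module ℂᵣ = CommutativeRing ℂ-commutativeRing
open RingProperties ℂᵣ.ring using (-1*x≈-x; -0#≈0#; -‿involutive; -‿distribʳ-*)
import Relation.Binary.Reasoning.Setoid ℂᵣ.setoid as ≈-Reasoning

-- Coefficients in the group algebra

module _ {n : ℕ} where

  private
    if-cong : ∀ {b c} {w z x y : ℂ} → b ≡ c → w ℂᵣ.≈ x → z ℂᵣ.≈ y →
              (if b then w else z) ℂᵣ.≈ (if c then x else y)
    if-cong {true}  refl p q = p
    if-cong {false} refl p q = q

    if-* : ∀ b c d → (if b then c *ᶜ d else 0ᶜ) ℂᵣ.≈ c *ᶜ (if b then d else 0ᶜ)
    if-* true  c d = ℂᵣ.refl
    if-* false c d = ℂᵣ.sym (ℂᵣ.zeroʳ c)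

  coeff-cong : ∀ (a : ℂ[S n ]) {σ τ} → σ Perm.≈ τ → coeff a σ ℂᵣ.≈ coeff a τ
  coeff-cong []            σ≈τ = ℂᵣ.refl
  coeff-cong ((c , ρ) ∷ a) {σ} {τ} σ≈τ = ℂᵣ.+-cong
    (if-cong (does-⇔ (mk⇔ (λ p i → trans (p i) (σ≈τ i)) (λ p i → trans (p i) (sym (σ≈τ i))))
                     (ρ ≟ₚ σ) (ρ ≟ₚ τ))
             ℂᵣ.refl ℂᵣ.refl)
    (coeff-cong a σ≈τ)

  coeff-++ : ∀ (a b : ℂ[S n ]) σ → coeff (a ++ b) σ ℂᵣ.≈ coeff a σ +ᶜ coeff b σ
  coeff-++ []            b σ = ℂᵣ.sym (ℂᵣ.+-identityˡ _)
  coeff-++ ((c , τ) ∷ a) b σ =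
    ℂᵣ.trans (ℂᵣ.+-congˡ (coeff-++ a b σ)) (ℂᵣ.sym (ℂᵣ.+-assoc _ _ _))

  coeff-• : ∀ c (a : ℂ[S n ]) σ → coeff (c • a) σ ℂᵣ.≈ c *ᶜ coeff a σ
  coeff-• c []            σ = ℂᵣ.sym (ℂᵣ.zeroʳ c)
  coeff-• c ((d , τ) ∷ a) σ = ℂᵣ.trans
    (ℂᵣ.+-cong (if-* (does (τ ≟ₚ σ)) c d) (coeff-• c a σ))
    (ℂᵣ.sym (ℂᵣ.distribˡ c _ _))

  -- Left translation by `τ` is a bijection of the group, so only the term at τ⁻¹σ lands on σ.
  -- `does-⇔` turns this equivalence into equal Boolean tests.
  coeff-translate : ∀ c τ (a : ℂ[S n ]) σ →
    coeff (map (λ (d , ρ) → c *ᶜ d , τ ∙ ρ) a) σ ℂᵣ.≈ c *ᶜ coeff a (Perm.flip τ ∙ σ)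
  coeff-translate c τ []            σ = ℂᵣ.sym (ℂᵣ.zeroʳ c)
  coeff-translate c τ ((d , ρ) ∷ a) σ = ℂᵣ.trans
    (ℂᵣ.+-cong
      (ℂᵣ.trans
        (if-cong (does-⇔ τρ≈σ⇔ρ≈τ⁻¹σ (τ ∙ ρ ≟ₚ σ) (ρ ≟ₚ Perm.flip τ ∙ σ)) ℂᵣ.refl ℂᵣ.refl)
        (if-* (does (ρ ≟ₚ Perm.flip τ ∙ σ)) c d))
      (coeff-translate c τ a σ))
    (ℂᵣ.sym (ℂᵣ.distribˡ c _ _))
    where
    τρ≈σ⇔ρ≈τ⁻¹σ : ((τ ∙ ρ) Perm.≈ σ) ⇔ (ρ Perm.≈ (Perm.flip τ ∙ σ))
    τρ≈σ⇔ρ≈τ⁻¹σ = mk⇔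
      (λ p i → trans (sym (inverseˡ τ)) (cong (τ ⟨$⟩ˡ_) (p i)))
      (λ p i → trans (cong (τ ⟨$⟩ʳ_) (p i)) (inverseʳ τ))

  -- The recursion that peels off the first factor of a product; the coefficients over a forest are
  -- computed by induction with it.
  coeff-𝟏⊖⟪_⟫⊛ : ∀ τ (a : ℂ[S n ]) σ →
    coeff ((𝟏 ⊖ ⟪ τ ⟫) ⊛ a) σ ℂᵣ.≈ coeff a σ ℂᵣ.- coeff a (Perm.flip τ ∙ σ)
  coeff-𝟏⊖⟪ τ ⟫⊛ a σ = begin
    -- The left factor has two terms, so `⊛` yields one translate of `a` for each, followed by an
    -- empty list.
    coeff (X ++ Y ++ []) σ          ≈⟨ coeff-++ X (Y ++ []) σ ⟩
    coeff X σ +ᶜ coeff (Y ++ []) σ  ≡⟨ cong (λ z → coeff X σ +ᶜ coeff z σ) (++-identityʳ Y) ⟩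
    coeff X σ +ᶜ coeff Y σ
      ≈⟨ ℂᵣ.+-cong (coeff-translate 1ᶜ Perm.id a σ) (coeff-translate (-ᶜ 1ᶜ) τ a σ) ⟩
    1ᶜ *ᶜ coeff a (Perm.flip Perm.id ∙ σ) +ᶜ (-ᶜ 1ᶜ) *ᶜ coeff a (Perm.flip τ ∙ σ)
      ≈⟨ ℂᵣ.+-cong (ℂᵣ.trans (ℂᵣ.*-identityˡ _) (coeff-cong a (λ _ → refl))) (-1*x≈-x _) ⟩
    coeff a σ ℂᵣ.- coeff a (Perm.flip τ ∙ σ) ∎
    where
    open ≈-Reasoning
    X Y : ℂ[S n ]
    X = map (λ (d , ρ) → 1ᶜ *ᶜ d , Perm.id ∙ ρ) a
    Y = map (λ (d , ρ) → (-ᶜ 1ᶜ) *ᶜ d , τ ∙ ρ) a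

-- Positive integers are nonzero in ℂ

0≤re-fromℕᶜ : ∀ k i → 0ℚ ℚ.≤ seq (re (fromℕᶜ k)) i
0≤re-fromℕᶜ zero    i = ℚ.≤-refl
0≤re-fromℕᶜ (suc k) i = ℚ.+-mono-≤ (ℚ.nonNegative⁻¹ 1ℚ) (0≤re-fromℕᶜ k i)

-- All real-part terms of the sequence representing a positive integer are at least 1, so they never
-- come within tolerance 1 of zero.
fromℕᶜ≉0 : ∀ k .{{_ : ℕ.NonZero k}} → ¬ (fromℕᶜ k ≈ᶜ 0ᶜ)
fromℕᶜ≉0 (suc k) (re≃0 , _) with close re≃0 1ℚ (ℚ.positive⁻¹ 1ℚ)
... | N , h = ℚ.<-irrefl refl (begin-strict
  1ℚ                ≡⟨ ℚ.+-identityʳ 1ℚ ⟨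
  1ℚ ℚ.+ 0ℚ         ≤⟨ ℚ.+-monoʳ-≤ 1ℚ (0≤re-fromℕᶜ k N) ⟩
  x                 ≡⟨ ℚ.+-identityʳ x ⟨
  x ℚ.- 0ℚ          ≤⟨ p≤∣p∣ (x ℚ.- 0ℚ) ⟩
  ∣ x ℚ.- 0ℚ ∣      <⟨ h N ℕ.≤-refl ⟩
  1ℚ                ∎)
  where
  open ℚ.≤-Reasoning
  x = seq (re (fromℕᶜ (suc k))) N
  p≤∣p∣ : ∀ p → p ℚ.≤ ∣ p ∣
  p≤∣p∣ p with ℚ.≤-total 0ℚ p
  ... | inj₁ 0≤p = ℚ.≤-reflexive (sym (ℚ.0≤p⇒∣p∣≡p 0≤p))
  ... | inj₂ p≤0 = ℚ.≤-trans p≤0 (ℚ.0≤∣p∣ p)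

-- Products over a forest

transpose-matchˡ : ∀ {n} (i j : Fin n) → Components.transpose i j i ≡ j
transpose-matchˡ i j rewrite dec-true (i Fin.≟ i) refl = refl

transpose-matchʳ : ∀ {n} (i j : Fin n) → Components.transpose i j j ≡ i
transpose-matchʳ i j with j Fin.≟ i
... | yes j≡i = j≡i
... | no  _   rewrite dec-true (j Fin.≟ j) refl = refl

transpose-mismatch : ∀ {n} {i j k : Fin n} → k ≢ i → k ≢ j → Components.transpose i j k ≡ k
transpose-mismatch {i = i} {j} {k} k≢i k≢j
  rewrite dec-false (k Fin.≟ i) k≢i | dec-false (k Fin.≟ j) k≢j = refl

module _ {n : ℕ} where

  Linked : ∀ {m} → (Fin m → Fin n × Fin n) → Rel (Fin n) 0ℓ
  Linked e x y = ∃[ i ] e i ≡ (x , y)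

  Reach : ∀ {m} → (Fin m → Fin n × Fin n) → Rel (Fin n) 0ℓ
  Reach e = EqClosure (Linked e)

  LinkedWithout : ∀ {m} → (Fin m → Fin n × Fin n) → Fin m → Rel (Fin n) 0ℓ
  LinkedWithout e i x y = ∃[ j ] j ≢ i × e j ≡ (x , y)

  -- Encoded by the property that the inductions use: every edge is a bridge. Removing edges by
  -- index excludes loops and repeated edges as well.
  IsForest : ∀ {m} → (Fin m → Fin n × Fin n) → Set
  IsForest e = ∀ i → ¬ EqClosure (LinkedWithout e i) (proj₁ (e i)) (proj₂ (e i))

  factors : ∀ {m} → (Fin m → Fin n × Fin n) → ℂ[S n ]
  factors e = ∏ (λ i → 𝟏 ⊖ ⟪ transpose (proj₁ (e i)) (proj₂ (e i)) ⟫)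

  tailForest : ∀ {m} {e : Fin (suc m) → Fin n × Fin n} → IsForest e → IsForest (e ∘ suc)
  tailForest forest i =
    forest (suc i) ∘ EqClosure.map λ (j , j≢i , eq) → suc j , j≢i ∘ Fin.suc-injective , eq

  module _ {m} (e : Fin (suc m) → Fin n × Fin n) where
    private
      p = proj₁ (e zero)
      q = proj₂ (e zero)

    liftReach : ∀ {x y} → Reach (e ∘ suc) x y → Reach e x y
    liftReach = EqClosure.map λ (i , eq) → suc i , eq

    -- The transposition either fixes `y` or moves it across the first edge. The order `q p` appears
    -- because flipping `transpose p q` swaps its arguments.
    transpose-reach : ∀ y → Reach e (Components.transpose q p y) y
    transpose-reach y with y Fin.≟ q
    ... | yes refl = fwd (zero , refl) ◅ ε
    ... | no  _ with y Fin.≟ p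
    ...   | yes refl = bwd (zero , refl) ◅ ε
    ...   | no  _    = ε

    -- The bridge condition at the first edge, phrased for the remaining edges so that induction
    -- steps can refute paths among them.
    head-unreachable : IsForest e → ¬ Reach (e ∘ suc) p q
    head-unreachable forest =
      forest zero ∘ EqClosure.map λ (i , eq) → suc i , (λ ()) , eq

    head-loopless : IsForest e → p ≢ q
    head-loopless forest p≡q = head-unreachable forest (subst (Reach (e ∘ suc) p) p≡q ε)

    private
      t : Permutation′ n
      t = Perm.flip (transpose p q)

    factors-step : ∀ σ {w z} →
      coeff (factors (e ∘ suc)) σ ℂᵣ.≈ w → coeff (factors (e ∘ suc)) (t ∙ σ) ℂᵣ.≈ z →
      coeff (factors e) σ ℂᵣ.≈ w ℂᵣ.- z
    factors-step σ w≈ z≈ = ℂᵣ.trans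
      (coeff-𝟏⊖⟪ transpose p q ⟫⊛ (factors (e ∘ suc)) σ)
      (ℂᵣ.+-cong w≈ (ℂᵣ.-‿cong z≈))

  private
    0-0 : 0ᶜ ℂᵣ.- 0ᶜ ℂᵣ.≈ 0ᶜ
    0-0 = ℂᵣ.-‿inverseʳ 0ᶜ

    x-0 : ∀ x → x ℂᵣ.- 0ᶜ ℂᵣ.≈ x
    x-0 x = ℂᵣ.trans (ℂᵣ.+-congˡ -0#≈0#) (ℂᵣ.+-identityʳ x)

  -- Every permutation occurring in the product moves points along paths of edges.
  coeff-unreachable : ∀ {m} (e : Fin m → Fin n × Fin n) σ x →
    ¬ Reach e x (σ ⟨$⟩ʳ x) → coeff (factors e) σ ℂᵣ.≈ 0ᶜ
  -- The empty product is the identity. If σ were the identity, `x` would reach its image by the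
  -- empty path.
  coeff-unreachable {zero} e σ x unreachable
    rewrite dec-false (Perm.id ≟ₚ σ) (λ id≈σ → unreachable (subst (Reach e x) (id≈σ x) ε))
    = ℂᵣ.+-identityʳ 0ᶜ
  coeff-unreachable {suc m} e σ x unreachable = ℂᵣ.trans
    (factors-step e σ
      (coeff-unreachable (e ∘ suc) σ x (unreachable ∘ liftReach e))
      -- `t` moves σ x at most across the first edge, so a path from `x` to t (σ x) extends to one
      -- ending at σ x.
      (coeff-unreachable (e ∘ suc) _ x
        (λ reach → unreachable (liftReach e reach ◅◅ transpose-reach e (σ ⟨$⟩ʳ x)))))
    0-0

  -- The tail contributes 1 by induction, while `t` sends `q` to `p`, which the later edges do not
  -- connect. Any σ fixing all points is allowed, because `coeff-edge` needs the case of a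
  -- transposition composed with its inverse.
  coeff-id : ∀ {m} (e : Fin m → Fin n × Fin n) → IsForest e →
    ∀ σ → (∀ x → σ ⟨$⟩ʳ x ≡ x) → coeff (factors e) σ ℂᵣ.≈ 1ᶜ
  coeff-id {zero} e forest σ σ≈id
    rewrite dec-true (Perm.id ≟ₚ σ) (sym ∘ σ≈id) = ℂᵣ.+-identityʳ 1ᶜ
  coeff-id {suc m} e forest σ σ≈id = ℂᵣ.trans
    (factors-step e σ
      (coeff-id (e ∘ suc) (tailForest forest) σ σ≈id)
      (coeff-unreachable (e ∘ suc) _ q λ reach → head-unreachable e forest
        (EqClosure.symmetric _ (subst (Reach (e ∘ suc) q) tσq≡p reach))))
    (x-0 1ᶜ)
    where
    p = proj₁ (e zero)
    q = proj₂ (e zero)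
    tσq≡p : Components.transpose q p (σ ⟨$⟩ʳ q) ≡ p
    tσq≡p = trans (cong (Components.transpose q p) (σ≈id q)) (transpose-matchˡ q p)

  module _ {m} (e : Fin (suc m) → Fin n × Fin n) (forest : IsForest e) {a b : Fin n} where
    private
      p = proj₁ (e zero)
      q = proj₂ (e zero)

    -- An endpoint of the first edge outside {a , b} would have to reach the
    -- other endpoint along the remaining edges.
    coeff-other-head : e zero ≢ (a , b) → e zero ≢ (b , a) →
      coeff (factors (e ∘ suc)) (Perm.flip (transpose p q) ∙ transpose a b) ℂᵣ.≈ 0ᶜ
    coeff-other-head ≢ab ≢ba with p Fin.≟ a | p Fin.≟ b | q Fin.≟ a | q Fin.≟ b
    ... | no p≢a | no p≢b | _ | _ = coeff-unreachable (e ∘ suc) _ p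
      λ reach → head-unreachable e forest (subst (Reach (e ∘ suc) p)
        (trans (cong (Components.transpose q p) (transpose-mismatch p≢a p≢b))
               (transpose-matchʳ q p)) reach)
    ... | _ | _ | no q≢a | no q≢b = coeff-unreachable (e ∘ suc) _ q
      λ reach → head-unreachable e forest (EqClosure.symmetric _ (subst (Reach (e ∘ suc) q)
        (trans (cong (Components.transpose q p) (transpose-mismatch q≢a q≢b))
               (transpose-matchˡ q p)) reach))
    -- Both endpoints now lie in {a , b}, so the first edge is either that edge itself or a loop.
    ... | yes p≡a | _ | _ | yes q≡b = contradiction (cong₂ _,_ p≡a q≡b) ≢ab
    ... | _ | yes p≡b | yes q≡a | _ = contradiction (cong₂ _,_ p≡b q≡a) ≢ba
    ... | yes p≡a | _ | yes q≡a | _ =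
      contradiction (trans p≡a (sym q≡a)) (head-loopless e forest)
    ... | _ | yes p≡b | _ | yes q≡b =
      contradiction (trans p≡b (sym q≡b)) (head-loopless e forest)

  -- Both terms of the recursion vanish. Requiring a ≢ b keeps `transpose a b` away from the
  -- identity, whose coefficient is 1.
  coeff-nonedge : ∀ {m} (e : Fin m → Fin n × Fin n) → IsForest e → ∀ {a b} → a ≢ b →
    (∀ i → e i ≢ (a , b)) → (∀ i → e i ≢ (b , a)) →
    coeff (factors e) (transpose a b) ℂᵣ.≈ 0ᶜ
  coeff-nonedge {zero} e forest {a} {b} a≢b ≢ab ≢ba
    rewrite dec-false (Perm.id ≟ₚ transpose a b)
              (λ id≈ → a≢b (trans (id≈ a) (transpose-matchˡ a b)))
    = ℂᵣ.+-identityʳ 0ᶜ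
  coeff-nonedge {suc m} e forest {a} {b} a≢b ≢ab ≢ba = ℂᵣ.trans
    (factors-step e (transpose a b)
      (coeff-nonedge (e ∘ suc) (tailForest forest) a≢b (≢ab ∘ suc) (≢ba ∘ suc))
      (coeff-other-head e forest (≢ab zero) (≢ba zero)))
    0-0

  -- If the edge comes first, its transposition is absent from the tail and `t` cancels it to the
  -- identity, which contributes -1. If it comes later, induction gives -1 and the other term
  -- vanishes.
  coeff-edge : ∀ {m} (e : Fin m → Fin n × Fin n) → IsForest e → ∀ {a b} i → e i ≡ (a , b) →
    coeff (factors e) (transpose a b) ℂᵣ.≈ -ᶜ 1ᶜ
  coeff-edge e forest zero refl = ℂᵣ.trans
    (factors-step e (transpose a b)
      (coeff-unreachable (e ∘ suc) _ a
        (head-unreachable e forest ∘ subst (Reach (e ∘ suc) a) (transpose-matchˡ a b)))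
      (coeff-id (e ∘ suc) (tailForest forest) _ λ x → inverseˡ (transpose a b)))
    (ℂᵣ.+-identityˡ _)
    where
    a = proj₁ (e zero)
    b = proj₂ (e zero)
  coeff-edge e forest {a} {b} (suc i) eᵢ≡ab = ℂᵣ.trans
    (factors-step e (transpose a b)
      (coeff-edge (e ∘ suc) (tailForest forest) i eᵢ≡ab)
      -- The first edge cannot also join `a` and `b`, since edge `i` of the tail would then bypass
      -- it.
      (coeff-other-head e forest
        (λ e₀≡ab → head-unreachable e forest
          (subst (λ (x , y) → Reach (e ∘ suc) x y) (sym e₀≡ab) reach))
        (λ e₀≡ba → head-unreachable e forest
          (subst (λ (x , y) → Reach (e ∘ suc) x y) (sym e₀≡ba)
            (EqClosure.symmetric _ reach)))))
    (x-0 _)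
    where
    reach : Reach (e ∘ suc) a b
    reach = fwd (i , eᵢ≡ab) ◅ ε

-- Simple paths and cycles

-- The vertices are indexed as in `Cycle`, so a path with at least two steps becomes a cycle once a
-- closing edge is supplied.
record SimplePath {A : Set} (R : Rel A 0ℓ) (x y : A) : Set where
  field
    {len}    : ℕ
    vertex   : Fin (suc len) → A
    distinct : Injective _≡_ _≡_ vertex
    start    : vertex zero ≡ x
    end      : vertex (fromℕ len) ≡ y
    step     : ∀ (i : Fin len) → R (vertex (inject₁ i)) (vertex (suc i))

module _ {A : Set} {R : Rel A 0ℓ} where
  open SimplePath

  suffix : ∀ {x y} (p : SimplePath R x y) i → SimplePath R (vertex p i) y
  suffix p zero = record
    { vertex = vertex p ; distinct = distinct p ; start = refl ; end = end p ; step = step p }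
  suffix {y = y} p (suc i) = go p i
    where
    go : ∀ {x} (p : SimplePath R x y) (i : Fin (len p)) → SimplePath R (vertex p (suc i)) y
    go record { len = suc _ ; vertex = v ; distinct = d ; end = e ; step = s } i = suffix
      (record { vertex = v ∘ suc ; distinct = Fin.suc-injective ∘ d
              ; start = refl ; end = e ; step = s ∘ suc }) i

  -- Loop erasure: simplify the rest of the walk, then either cut back to an earlier visit of `x` on
  -- it or prepend `x`.
  simplify : DecidableEquality A → ∀ {x y} → Star R x y → SimplePath R x y
  simplify _≟_ {x} ε = record
    { len = zero ; vertex = λ _ → x ; distinct = λ { {zero} {zero} _ → refl }
    ; start = refl ; end = refl ; step = λ () }
  simplify _≟_ {x} {y} (xRz ◅ walk) = extend (simplify _≟_ walk)
    where
    extend : SimplePath R _ y → SimplePath R x y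
    extend p with Fin.any? (λ i → vertex p i ≟ x)
    ... | yes (i , pᵢ≡x) = subst (λ z → SimplePath R z y) pᵢ≡x (suffix p i)
    ... | no  x∉p = record
      { vertex = v ; distinct = v-distinct ; start = refl ; end = end p ; step = v-step }
      where
      v : Fin (2 ℕ.+ len p) → A
      v zero    = x
      v (suc i) = vertex p i

      v-distinct : Injective _≡_ _≡_ v
      v-distinct {zero}  {zero}  _  = refl
      v-distinct {zero}  {suc j} eq = contradiction (j , sym eq) x∉p
      v-distinct {suc i} {zero}  eq = contradiction (i , eq) x∉p
      v-distinct {suc i} {suc j} eq = cong suc (distinct p eq)

      v-step : ∀ i → R (v (inject₁ i)) (v (suc i))
      v-step zero    = subst (R x) (sym (start p)) xRz
      v-step (suc i) = step p i

-- Acyclic graphs and the coefficients of `𝒦`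

module _ (G : Graph) {n : ℕ} (ℒ : Graph.V G ⤖ Fin n) where
  open Graph G

  private
    module ℒ = Inverse (⤖⇒↔ ℒ)

  edgeLabels : ∀ {m} → Ordering G m → Fin m → Fin n × Fin n
  edgeLabels π i = ℒ.to (proj₁ (proj₁ e)) , ℒ.to (proj₂ (proj₁ e))
    where e = Bijection.to π i

  AdjacentWithout : Edge G → Rel V 0ℓ
  AdjacentWithout e x y = Σ[ x~y ∈ x ~ y ] ¬ _≈ₑ_ G ((x , y) , x~y) e

  -- A walk avoiding the edge shortens to a simple path. Length 0 would make the edge a loop, length
  -- 1 would use the edge itself, and any greater length closes up to a cycle.
  edge-bridge : ¬ Cycle G → ∀ (e@((u , v) , _) : Edge G) → ¬ Star (AdjacentWithout e) u v
  edge-bridge acyclic ((u , v) , u~v) walk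
    -- Equality of vertices is decidable because labels are.
    with simplify (via-injection (Bijection.injection ℒ) Fin._≟_) walk
  ... | record { len = zero ; start = s ; end = e } =
    ~-irrefl (trans (sym s) e) u~v
  ... | record { len = suc zero ; start = s ; end = e ; step = step } =
    proj₂ (step zero) (inj₁ (s , e))
  ... | record { len = suc (suc k) ; vertex = p ; distinct = d ; start = s ; end = e ; step = step } =
    acyclic record
      { vertex = p ; distinct = d ; step = proj₁ ∘ step
      ; closing = subst₂ _~_ (sym e) (sym s) (~-sym u~v) }

  -- A walk between labels pulls back to a walk between vertices; injectivity of `π` turns a
  -- different index into a different edge.
  labels-forest : ¬ Cycle G → ∀ {m} (π : Ordering G m) → IsForest (edgeLabels π)
  labels-forest acyclic π i walk =
    edge-bridge acyclic (π.to i)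
      (subst₂ (Star (AdjacentWithout (π.to i))) (ℒ.strictlyInverseʳ _) (ℒ.strictlyInverseʳ _)
        (Star.gmap ℒ.from adjacent walk))
    where
    module π = Bijection π

    forward : ∀ {x y} → LinkedWithout (edgeLabels π) i x y →
              AdjacentWithout (π.to i) (ℒ.from x) (ℒ.from y)
    forward (j , j≢i , refl)
      rewrite ℒ.strictlyInverseʳ (proj₁ (proj₁ (π.to j)))
            | ℒ.strictlyInverseʳ (proj₂ (proj₁ (π.to j))) =
      proj₂ (π.to j) , j≢i ∘ π.injective

    swap : ∀ {x y} → AdjacentWithout (π.to i) x y → AdjacentWithout (π.to i) y x
    swap (x~y , ≉) = ~-sym x~y , λ { (inj₁ (p , q)) → ≉ (inj₂ (q , p))
                                   ; (inj₂ (p , q)) → ≉ (inj₁ (q , p)) }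

    adjacent : ∀ {x y} → SymClosure (LinkedWithout (edgeLabels π) i) x y →
               AdjacentWithout (π.to i) (ℒ.from x) (ℒ.from y)
    adjacent (fwd r) = forward r
    adjacent (bwd r) = swap (forward r)

  coeff-𝒦-edge : ¬ Cycle G → ∀ {m} (π : Ordering G m) i →
    let a , b = edgeLabels π i in
    coeff (𝒦 G ℒ π) (transpose a b) ℂᵣ.≈ fromℕᶜ (n !) *ᶜ -ᶜ 1ᶜ
  coeff-𝒦-edge acyclic π i = ℂᵣ.trans
    (coeff-• (fromℕᶜ (n !)) (factors (edgeLabels π)) _)
    (ℂᵣ.*-congˡ (coeff-edge (edgeLabels π) (labels-forest acyclic π) i refl))

  coeff-𝒦-nonedge : ¬ Cycle G → ∀ {m} (π : Ordering G m) {u v} → u ≢ v → ¬ u ~ v →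
    coeff (𝒦 G ℒ π) (transpose (ℒ.to u) (ℒ.to v)) ℂᵣ.≈ 0ᶜ
  coeff-𝒦-nonedge acyclic π {u} {v} u≢v u≁v = ℂᵣ.trans
    (coeff-• (fromℕᶜ (n !)) (factors (edgeLabels π)) _)
    (ℂᵣ.trans
      (ℂᵣ.*-congˡ (coeff-nonedge (edgeLabels π) (labels-forest acyclic π)
        (u≢v ∘ Bijection.injective ℒ) (λ i → u≁v ∘ adjacent i) (λ i → u≁v ∘ ~-sym ∘ adjacent i)))
      (ℂᵣ.zeroʳ (fromℕᶜ (n !))))
    where
    adjacent : ∀ i {x y} → edgeLabels π i ≡ (ℒ.to x , ℒ.to y) → x ~ y
    adjacent i eq = subst₂ _~_
      (Bijection.injective ℒ (,-injectiveˡ eq)) (Bijection.injective ℒ (,-injectiveʳ eq))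
      (proj₂ (Bijection.to π i))

-- Recovering adjacency from `𝒦`

module _ (G H : Graph) {n} (ℒ : Graph.V G ⤖ Fin n) (ℒ′ : Graph.V H ⤖ Fin n) where
  private
    module G = Graph G
    module H = Graph H
    open Bijection ℒ using () renaming (to to ℓ)
    open Bijection ℒ′ using () renaming (to to ℓ′)

  private
    fromℕᶜ*-1≉0 : ∀ k .{{_ : ℕ.NonZero k}} → ¬ (fromℕᶜ k *ᶜ -ᶜ 1ᶜ ≈ᶜ 0ᶜ)
    fromℕᶜ*-1≉0 k k*-1≈0 = fromℕᶜ≉0 k (begin
      x                      ≈⟨ -‿involutive x ⟨
      -ᶜ (-ᶜ x)              ≈⟨ ℂᵣ.-‿cong (ℂᵣ.-‿cong (ℂᵣ.*-identityʳ x)) ⟨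
      -ᶜ (-ᶜ (x *ᶜ 1ᶜ))      ≈⟨ ℂᵣ.-‿cong (-‿distribʳ-* x 1ᶜ) ⟩
      -ᶜ (x *ᶜ -ᶜ 1ᶜ)        ≈⟨ ℂᵣ.-‿cong k*-1≈0 ⟩
      -ᶜ 0ᶜ                  ≈⟨ -0#≈0# ⟩
      0ᶜ                     ∎)
      where
      open ≈-Reasoning
      x = fromℕᶜ k

  -- An edge has coefficient -n! and a pair of distinct non-adjacent vertices has 0. Decidable
  -- adjacency in `H` reduces the claim to refuting the second case.
  𝒦-determines-adjacency : ¬ Cycle G → ¬ Cycle H →
    ∀ {m m′} (π : Ordering G m) (π′ : Ordering H m′) → 𝒦 G ℒ π ≋ 𝒦 H ℒ′ π′ →
    ∀ {u v u′ v′} → ℓ u ≡ ℓ′ u′ → ℓ v ≡ ℓ′ v′ → u G.~ v → u′ H.~ v′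
  𝒦-determines-adjacency acyclicG acyclicH π π′ 𝒦≋𝒦′ u↦ v↦ u~v =
    -- Surjectivity of `π` finds the edge only up to orientation.
    reorient {u~v = u~v} (Bijection.strictlySurjective π (_ , u~v)) u↦ v↦
    where
    transfer : ∀ i {x y} →
               ℓ (proj₁ (proj₁ (Bijection.to π i))) ≡ ℓ′ x →
               ℓ (proj₂ (proj₁ (Bijection.to π i))) ≡ ℓ′ y → x H.~ y
    transfer i {x} {y} p q with x H.~? y
    ... | yes x~y = x~y
    ... | no  x≁y = ⊥-elim (fromℕᶜ*-1≉0 (n !) {{n ℕ.!≢0}} (begin
      fromℕᶜ (n !) *ᶜ -ᶜ 1ᶜ                        ≈⟨ coeff-𝒦-edge G ℒ acyclicG π i ⟨
      coeff (𝒦 G ℒ π) σ                            ≈⟨ 𝒦≋𝒦′ σ ⟩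
      coeff (𝒦 H ℒ′ π′) σ
        ≡⟨ cong₂ (λ a b → coeff (𝒦 H ℒ′ π′) (transpose a b)) p q ⟩
      coeff (𝒦 H ℒ′ π′) (transpose (ℓ′ x) (ℓ′ y))
        ≈⟨ coeff-𝒦-nonedge H ℒ′ acyclicH π′ x≢y x≁y ⟩
      0ᶜ                                           ∎))
      where
      open ≈-Reasoning
      σ = transposition G ℒ (Bijection.to π i)
      -- Equal vertices in `H` would have equal labels and make the edge of `G` a loop.
      x≢y : x ≢ y
      x≢y x≡y = G.~-irrefl
        (Bijection.injective ℒ (trans p (trans (cong ℓ′ x≡y) (sym q))))
        (proj₂ (Bijection.to π i))

    reorient : ∀ {u v u′ v′} {u~v : u G.~ v} →
               ∃[ i ] _≈ₑ_ G (Bijection.to π i) ((u , v) , u~v) →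
               ℓ u ≡ ℓ′ u′ → ℓ v ≡ ℓ′ v′ → u′ H.~ v′
    reorient (i , inj₁ (refl , refl)) u↦ v↦ = transfer i u↦ v↦
    reorient (i , inj₂ (refl , refl)) u↦ v↦ = H.~-sym (transfer i v↦ u↦)

-- Orderings of the edges

lookup-injective : ∀ {A : Set} {xs : List A} → Unique xs → Injective _≡_ _≡_ (lookup xs)
lookup-injective (x∉xs ∷ u) {zero}  {zero}  eq = refl
lookup-injective (x∉xs ∷ u) {zero}  {suc j} eq = contradiction eq (All.lookup x∉xs (∈-lookup j))
lookup-injective (x∉xs ∷ u) {suc i} {zero}  eq = contradiction (sym eq) (All.lookup x∉xs (∈-lookup i))
lookup-injective (x∉xs ∷ u) {suc i} {suc j} eq = cong suc (lookup-injective u eq)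

module _ (G : Graph) {n : ℕ} (ℒ : Graph.V G ⤖ Fin n) where
  open Graph G
  private
    module ℒ = Inverse (⤖⇒↔ ℒ)

    -- Requiring a < b selects one of the two orientations, so each edge is listed exactly once.
    Oriented : Fin n × Fin n → Set
    Oriented (a , b) = a < b × ℒ.from a ~ ℒ.from b

    oriented? : ∀ ab → Dec (Oriented ab)
    oriented? (a , b) = (a Fin.<? b) ×-dec (ℒ.from a ~? ℒ.from b)

    pairs : List (Fin n × Fin n)
    pairs = cartesianProduct (allFin n) (allFin n)

    edges : List (Fin n × Fin n)
    edges = filter oriented? pairs

    edges-unique : Unique edges
    edges-unique = Unique.filter⁺ oriented?
      (Unique.cartesianProduct⁺ (Unique.allFin⁺ n) (Unique.allFin⁺ n))

    oriented : ∀ i → Oriented (lookup edges i)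
    oriented i = proj₂ (∈-filter⁻ oriented? {xs = pairs} (∈-lookup i))

    edge : Fin (length edges) → Edge G
    edge i = _ , proj₂ (oriented i)

    from-injective : ∀ {a b} → ℒ.from a ≡ ℒ.from b → a ≡ b
    from-injective {a} {b} eq =
      trans (sym (ℒ.strictlyInverseˡ a)) (trans (cong ℒ.to eq) (ℒ.strictlyInverseˡ b))

    edge-injective : ∀ {i j} → _≈ₑ_ G (edge i) (edge j) → i ≡ j
    edge-injective (inj₁ (p , q)) =
      lookup-injective edges-unique (cong₂ _,_ (from-injective p) (from-injective q))
    edge-injective {i} {j} (inj₂ (p , q)) = contradiction
      (subst₂ _<_ (from-injective p) (from-injective q) (proj₁ (oriented i)))
      (Fin.<-asym (proj₁ (oriented j)))

    edge-covers : ∀ u v → ℒ.to u < ℒ.to v → u ~ v →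
                  ∃[ i ] (proj₁ (proj₁ (edge i)) ≡ u × proj₂ (proj₁ (edge i)) ≡ v)
    edge-covers u v u<v u~v = index uv∈edges
      , trans (cong (ℒ.from ∘ proj₁) (sym (lookup-index uv∈edges))) (ℒ.strictlyInverseʳ u)
      , trans (cong (ℒ.from ∘ proj₂) (sym (lookup-index uv∈edges))) (ℒ.strictlyInverseʳ v)
      where
      uv∈edges : (ℒ.to u , ℒ.to v) ∈ edges
      uv∈edges = ∈-filter⁺ oriented? (∈-cartesianProduct⁺ (∈-allFin _) (∈-allFin _))
        (u<v , subst₂ _~_ (sym (ℒ.strictlyInverseʳ u)) (sym (ℒ.strictlyInverseʳ v)) u~v)

    edge-surjective : ∀ e → ∃[ i ] _≈ₑ_ G (edge i) e
    -- Comparing the labels tells which orientation is listed.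
    edge-surjective ((u , v) , u~v) with Fin.<-cmp (ℒ.to u) (ℒ.to v)
    ... | tri< u<v _ _ = let i , eqs = edge-covers u v u<v u~v in i , inj₁ eqs
    ... | tri≈ _ u≡v _ = contradiction u~v (~-irrefl (Bijection.injective ℒ u≡v))
    ... | tri> _ _ v<u = let i , eqs = edge-covers v u v<u (~-sym u~v) in i , inj₂ eqs

  ordering : Ordering G (length edges)
  ordering = record
    { to        = edge
    ; cong      = λ { refl → inj₁ (refl , refl) }
    ; bijective = edge-injective , λ e →
        let i , eq = edge-surjective e in i , λ { refl → eq }
    }

-- Each edge keeps its position, so the factors of the two products correspond one by one.
mapOrdering : ∀ {G H : Graph} → G ≅ H → ∀ {m} → Ordering G m → Ordering H m
mapOrdering {G} {H} G≅H π = record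
  { to        = λ i → mapEdge (π.to i)
  ; cong      = λ { refl → inj₁ (refl , refl) }
  ; bijective = (λ { (inj₁ (p , q)) → π.injective (inj₁ (φ.injective p , φ.injective q))
                   ; (inj₂ (p , q)) → π.injective (inj₂ (φ.injective p , φ.injective q)) })
              , surjective
  }
  where
  module π = Bijection π
  module φ = Bijection (_≅_.bijection G≅H)
  module H = Graph H

  mapEdge : Edge G → Edge H
  mapEdge ((u , v) , u~v) =
    (φ.to u , φ.to v) , Equivalence.to (_≅_.adjacency G≅H u v) u~v

  surjective : ∀ e → ∃[ i ] (∀ {j} → j ≡ i → _≈ₑ_ H (mapEdge (π.to j)) e)
  surjective ((x , y) , x~y) =
    let u , u↦x = φ.strictlySurjective x
        v , v↦y = φ.strictlySurjective y
        u~v = Equivalence.from (_≅_.adjacency G≅H u v) (subst₂ H._~_ (sym u↦x) (sym v↦y) x~y)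
        i , eq = π.strictlySurjective ((u , v) , u~v)
    in i , λ { refl → image (π.to i) u~v u↦x v↦y eq }
    where
    image : ∀ e {u v} (u~v : Graph._~_ G u v) → φ.to u ≡ x → φ.to v ≡ y →
            _≈ₑ_ G e ((u , v) , u~v) → _≈ₑ_ H (mapEdge e) ((x , y) , x~y)
    image _ _ refl refl (inj₁ (refl , refl)) = inj₁ (refl , refl)
    image _ _ refl refl (inj₂ (refl , refl)) = inj₂ (refl , refl)

mainTheorem8 : ∀ (n : ℕ) (T₁ T₂ : Graph) → IsTree T₁ → IsTree T₂ →
    (Graph.V T₁ ⤖ Fin n) → (Graph.V T₂ ⤖ Fin n) →
    Satisfiable (𝒮 T₁ n ∩ 𝒮 T₂ n) ⇔ (T₁ ≅ T₂)
mainTheorem8 n T₁ T₂ tree₁ tree₂ ℒ₁ ℒ₂ = mk⇔ isomorphic common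
  where
  isomorphic : Satisfiable (𝒮 T₁ n ∩ 𝒮 T₂ n) → T₁ ≅ T₂
  isomorphic (a , (ℒ , _ , π , a≋𝒦) , (ℒ′ , _ , π′ , a≋𝒦′)) = record
    -- Vertices are matched when they carry the same label.
    { bijection = ⤖-sym ℒ′ ⤖-∘ ℒ
    ; adjacency = λ u v → mk⇔
        (𝒦-determines-adjacency T₁ T₂ ℒ ℒ′ (acyclic tree₁) (acyclic tree₂) π π′
          𝒦≋𝒦′ (sym (matched u)) (sym (matched v)))
        (𝒦-determines-adjacency T₂ T₁ ℒ′ ℒ (acyclic tree₂) (acyclic tree₁) π′ π
          (λ σ → ℂᵣ.sym (𝒦≋𝒦′ σ)) (matched u) (matched v))
    }
    where
    open IsTree
    𝒦≋𝒦′ : 𝒦 T₁ ℒ π ≋ 𝒦 T₂ ℒ′ π′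
    𝒦≋𝒦′ σ = ℂᵣ.trans (ℂᵣ.sym (a≋𝒦 σ)) (a≋𝒦′ σ)

    matched : ∀ u → Bijection.to ℒ′ (Bijection.to (⤖-sym ℒ′) (Bijection.to ℒ u)) ≡ Bijection.to ℒ u
    matched u = proj₂ (Bijection.strictlySurjective ℒ′ (Bijection.to ℒ u))

  common : T₁ ≅ T₂ → Satisfiable (𝒮 T₁ n ∩ 𝒮 T₂ n)
  -- Labeling `T₁` through `φ` gives corresponding edges the same transposition, so the two products
  -- are definitionally equal.
  common φ = 𝒦 T₂ ℒ₂ (mapOrdering φ π)
    , (ℒ₂ ⤖-∘ _≅_.bijection φ , _ , π , λ σ → ℂᵣ.refl)
    , (ℒ₂ , _ , mapOrdering φ π , λ σ → ℂᵣ.refl)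
    where π = ordering T₁ ℒ₁
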